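{- Let $k$ be a positive integer. For the higher order Mersenne numbers $\{M_n^{(k)}\}$ and every integer $s\ge 1$, we have 1. $$\sum_{n=0}^{s-1}\binom{s-1}{n}M_{n}^{(k)}= \frac{(1+2^k)^{s-1}-2^{s-1}}{2^k-1}.$$ 2. $$\sum_{n=0}^{s-1}(-1)^n\binom{s-1}{n}M_{n}^{(k)}=(-1)^{s-1}M_k^{\,s-2}.$$
   Context: The Mersenne numbers $\{M_n\}_{n\ge 0}$ are defined by $M_0=0$, $M_1=1$, $M_{n+2}=3M_{n+1}-2M_n$, i.e. $M_n=2^n-1$. For a positive integer $k$, the higher order Mersenne numbers are $M_n^{(k)}=M_{kn}/M_k$ for $n=0,1,2,\dots$. $M_k^{\,s-2}$ denotes the $(s-2)$th power of $M_k$.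
   Formalization: Part 2 is stated for s ≥ 2 instead of s ≥ 1, because at s = 1 it is false for every k: the left side is M_0^{(k)} = 0, while the right side is M_k^{ -1}, which is nonzero. -}

module Defs where

open import Data.Integer.Base using (ℤ; +_; _+_; _-_; _*_; _^_; NonZero)
import Data.Integer.Properties as ℤ
open import Data.Integer.Solver using (module +-*-Solver)
open import Data.Nat.Base as ℕ using (ℕ; zero; suc; z≤n; s≤s)
import Data.Nat.Properties as ℕ
open import Data.Nat.Coprimality using (1-coprimeTo) renaming (sym to coprime-sym)
open import Data.Rational.Base using (ℚ; mkℚ; _÷_)
open import Data.Rational.Properties using (+-0-commutativeMonoid)
open import Relation.Binary.PropositionalEquality

open import Algebra.Properties.CommutativeMonoid.Sum +-0-commutativeMonoid public
  using (sum⁺-syntax)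

M : ℕ → ℤ
M 0             = + 0
M 1             = + 1
M (suc (suc n)) = + 3 * M (suc n) - + 2 * M n

-- Built with mkℚ rather than i / 1, so that ℚ.NonZero (fromℤ i) is
-- definitionally ℤ.NonZero i.
fromℤ : ℤ → ℚ
fromℤ i = mkℚ i 0 (coprime-sym (1-coprimeTo _))

infixl 7 _÷ℤ_

_÷ℤ_ : (i j : ℤ) .{{_ : NonZero j}} → ℚ
i ÷ℤ j = fromℤ i ÷ fromℤ j

M-closed : ∀ n → M n ≡ (+ 2) ^ n - + 1
M-closed 0 = refl
M-closed 1 = refl
M-closed (suc (suc n)) rewrite M-closed (suc n) | M-closed n =
  solve 1 (λ x → con (+ 3) :* (con (+ 2) :* x :- con (+ 1))
                   :- con (+ 2) :* (x :- con (+ 1))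
              := con (+ 2) :* (con (+ 2) :* x) :- con (+ 1))
    refl ((+ 2) ^ n)
  where open +-*-Solver

pos-2^ : ∀ n → + (2 ℕ.^ n) ≡ (+ 2) ^ n
pos-2^ zero    = refl
pos-2^ (suc n) = trans (ℤ.pos-* 2 (2 ℕ.^ n)) (cong (+ 2 *_) (pos-2^ n))

2^k-1≢0 : ∀ k .{{_ : ℕ.NonZero k}} → NonZero ((+ 2) ^ k - + 1)
2^k-1≢0 k@(suc _) = subst (λ i → NonZero (i - + 1)) (pos-2^ k)
  (pred≢0 (ℕ.^-monoʳ-≤ 2 {1} {k} (s≤s z≤n)))
  where
  pred≢0 : ∀ {m} → 2 ℕ.≤ m → NonZero (+ m - + 1)
  pred≢0 (s≤s (s≤s _)) = _

Mₖ≢0 : ∀ k .{{_ : ℕ.NonZero k}} → NonZero (M k)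
Mₖ≢0 k = subst NonZero (sym (M-closed k)) (2^k-1≢0 k)

higherM : (k : ℕ) .{{_ : ℕ.NonZero k}} → ℕ → ℚ
higherM k n = M (k ℕ.* n) ÷ℤ M k
  where instance _ = Mₖ≢0 k

{-# OPTIONS --safe #-}
-- Since M_{kn} = (2^k)^n - 1, the binomial theorem, applied once at e 2^k and
-- once at e, gives
--   ∑_{n ≤ m} e^n C(m,n) M_{kn} = (1 + e 2^k)^m - (1 + e)^m    over ℤ.
-- Dividing by M_k, e = 1 is the first identity.  For e = -1 and m ≥ 1 the last
-- power vanishes and 1 - 2^k = - M_k, so one factor M_k cancels.
module Submission where

open import Defs
open import Algebra.Bundles using (module CommutativeRing)
open import Data.Fin.Base using (Fin; toℕ; zero; suc)
open import Data.Integer.Base as ℤ using (ℤ; +_; -1ℤ; 0ℤ; 1ℤ; _+_; _-_; _*_; _^_)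
import Data.Integer.Properties as ℤ
open import Data.Integer.Solver using (module +-*-Solver)
open import Data.Nat.Base as ℕ using (ℕ; zero; suc; _∸_; _≤_; s≤s)
open import Data.Nat.Combinatorics using (_C_)
open import Data.Product.Base using (_×_; _,_)
open import Data.Rational.Base as ℚ using (ℚ)
import Data.Rational.Properties as ℚ
open import Data.Vec.Functional using (Vector)
open import Function.Base using (_∘_)
open import Relation.Binary.PropositionalEquality
  using (_≡_; refl; sym; trans; cong; cong₂; module ≡-Reasoning)

private
  module ℤR = CommutativeRing ℤ.+-*-commutativeRing
  module ℚR = CommutativeRing ℚ.+-*-commutativeRing
  open import Algebra.Properties.CommutativeSemiring.Binomial ℤR.commutativeSemiring
    using () renaming (theorem to binomial-theorem)
  open import Algebra.Properties.CommutativeSemiring.Exp ℤR.commutativeSemiring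
    using (^-distrib-*) renaming (_^_ to _^ᴿ_)
  open import Algebra.Properties.Semiring.Mult ℤR.semiring
    using () renaming (_×_ to _×ᴿ_)
  import Algebra.Properties.Semiring.Sum ℤR.semiring as ℤΣ
  import Algebra.Properties.Semiring.Sum ℚR.semiring as ℚΣ

open ≡-Reasoning

-- An integer over 1 is already in lowest terms, so normalisation leaves it alone. Rational sums and
-- products unfold to `_/_`, and this leads from there back to `fromℤ`.
fromℤ≡/1 : ∀ i → i ℚ./ 1 ≡ fromℤ i
fromℤ≡/1 i = ℚ.↥p/↧p≡p (fromℤ i)

fromℤ-homo-+ : ∀ i j → fromℤ (i + j) ≡ fromℤ i ℚ.+ fromℤ j
fromℤ-homo-+ i j = begin
  fromℤ (i + j)                ≡⟨ fromℤ≡/1 (i + j) ⟨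
  -- The sum of two fractions with denominator 1 unfolds by cross-multiplication to
  -- `(i * 1ℤ + j * 1ℤ) / 1`, so only the factors `1ℤ` have to be inserted.
  (i + j) ℚ./ 1                ≡⟨ cong (ℚ._/ 1) (cong₂ _+_ (ℤ.*-identityʳ i) (ℤ.*-identityʳ j)) ⟨
  (i * 1ℤ + j * 1ℤ) ℚ./ 1      ∎

fromℤ-homo-* : ∀ i j → fromℤ (i * j) ≡ fromℤ i ℚ.* fromℤ j
fromℤ-homo-* i j = sym (fromℤ≡/1 (i * j))

fromℤ-homo-sum : ∀ {n} (f : Vector ℤ n) → fromℤ (ℤΣ.sum f) ≡ ℚΣ.sum (fromℤ ∘ f)
fromℤ-homo-sum {zero}  f = refl
fromℤ-homo-sum {suc n} f = trans (fromℤ-homo-+ (f zero) (ℤΣ.sum (f ∘ suc)))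
  (cong (fromℤ (f zero) ℚ.+_) (fromℤ-homo-sum (f ∘ suc)))

-- The nonzero proof depends on the divisor, so plain `cong` does not apply. Once the divisors are
-- identified, irrelevance makes the two proofs agree.
÷ℤ-congʳ : ∀ i {j k} .{{_ : ℤ.NonZero j}} .{{_ : ℤ.NonZero k}} → j ≡ k → i ÷ℤ j ≡ i ÷ℤ k
÷ℤ-congʳ i refl = refl

i*j÷ℤj≡i : ∀ i j .{{_ : ℤ.NonZero j}} → (i * j) ÷ℤ j ≡ fromℤ i
i*j÷ℤj≡i i j = begin
  fromℤ (i * j) ℚ.* 1/j          ≡⟨ cong (ℚ._* 1/j) (fromℤ-homo-* i j) ⟩
  fromℤ i ℚ.* fromℤ j ℚ.* 1/j    ≡⟨ ℚ.*-assoc (fromℤ i) (fromℤ j) 1/j ⟩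
  fromℤ i ℚ.* (fromℤ j ℚ.* 1/j)  ≡⟨ cong (fromℤ i ℚ.*_) (ℚ.*-inverseʳ (fromℤ j)) ⟩
  fromℤ i ℚ.* ℚ.1ℚ               ≡⟨ ℚ.*-identityʳ (fromℤ i) ⟩
  fromℤ i                        ∎
  where 1/j = ℚ.1/ fromℤ j

-- The binomial theorem is phrased with the powers and multiples of a general semiring; this and the
-- next lemma translate them to integer arithmetic.
^ᴿ≡^ : ∀ i n → i ^ᴿ n ≡ i ^ n
^ᴿ≡^ i zero    = refl
^ᴿ≡^ i (suc n) = cong (i *_) (^ᴿ≡^ i n)

×ᴿ≡* : ∀ n i → n ×ᴿ i ≡ + n * i
×ᴿ≡* zero    i = sym (ℤ.*-zeroˡ i)
×ᴿ≡* (suc n) i = trans (cong (_+_ i) (×ᴿ≡* n i)) (sym (ℤ.suc-* (+ n) i))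

[i*j]^n≡i^n*j^n : ∀ i j n → (i * j) ^ n ≡ i ^ n * j ^ n
[i*j]^n≡i^n*j^n i j n = begin
  (i * j) ^ n      ≡⟨ ^ᴿ≡^ (i * j) n ⟨
  (i * j) ^ᴿ n     ≡⟨ ^-distrib-* i j n ⟩
  i ^ᴿ n * j ^ᴿ n  ≡⟨ cong₂ _*_ (^ᴿ≡^ i n) (^ᴿ≡^ j n) ⟩
  i ^ n * j ^ n    ∎

-- The binomial theorem for `x + 1ℤ`: the powers of `1ℤ` drop out of every term.
sum-binomial : ∀ m x → ℤΣ.sum {suc m} (λ j → + (m C toℕ j) * x ^ toℕ j) ≡ (+ 1 + x) ^ m
sum-binomial m x = begin
  ℤΣ.sum {suc m} (λ j → + (m C toℕ j) * x ^ toℕ j)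
    ≡⟨ ℤΣ.sum-cong-≗ term ⟨
  ℤΣ.sum {suc m} (λ j → (m C toℕ j) ×ᴿ (x ^ᴿ toℕ j * 1ℤ ^ᴿ (m ∸ toℕ j)))
    ≡⟨ binomial-theorem m x 1ℤ ⟨
  (x + 1ℤ) ^ᴿ m  ≡⟨ ^ᴿ≡^ (x + 1ℤ) m ⟩
  (x + 1ℤ) ^ m   ≡⟨ cong (_^ m) (ℤ.+-comm x 1ℤ) ⟩
  (+ 1 + x) ^ m  ∎
  where
  term : (j : Fin (suc m)) →
    (m C toℕ j) ×ᴿ (x ^ᴿ toℕ j * 1ℤ ^ᴿ (m ∸ toℕ j)) ≡ + (m C toℕ j) * x ^ toℕ j
  term j = begin
    (m C toℕ j) ×ᴿ (x ^ᴿ toℕ j * 1ℤ ^ᴿ (m ∸ toℕ j))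
      ≡⟨ ×ᴿ≡* (m C toℕ j) _ ⟩
    + (m C toℕ j) * (x ^ᴿ toℕ j * 1ℤ ^ᴿ (m ∸ toℕ j))
      ≡⟨ cong (+ (m C toℕ j) *_) (cong₂ _*_ (^ᴿ≡^ x (toℕ j))
           (trans (^ᴿ≡^ 1ℤ (m ∸ toℕ j)) (ℤ.^-zeroˡ (m ∸ toℕ j)))) ⟩
    + (m C toℕ j) * (x ^ toℕ j * 1ℤ)
      ≡⟨ cong (+ (m C toℕ j) *_) (ℤ.*-identityʳ (x ^ toℕ j)) ⟩
    + (m C toℕ j) * x ^ toℕ j ∎

sum-binomial-M : ∀ k e m →
  ℤΣ.sum {suc m} (λ j → e ^ toℕ j * + (m C toℕ j) * M (k ℕ.* toℕ j))
    ≡ (+ 1 + e * (+ 2) ^ k) ^ m - (+ 1 + e) ^ m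
sum-binomial-M k e m = begin
  ℤΣ.sum {suc m} (λ j → e ^ toℕ j * + (m C toℕ j) * M (k ℕ.* toℕ j))
    ≡⟨ ℤΣ.sum-cong-≗ {suc m} (λ j → term (toℕ j)) ⟩
  -- Subtraction is written as adding a multiple by `-1ℤ`, so that additivity and distributivity of
  -- sums split off two binomial sums.
  ℤΣ.sum {suc m} (λ j → powers (e * (+ 2) ^ k) j + -1ℤ * powers e j)
    ≡⟨ ℤΣ.∑-distrib-+ (powers (e * (+ 2) ^ k)) (λ j → -1ℤ * powers e j) ⟩
  ℤΣ.sum (powers (e * (+ 2) ^ k)) + ℤΣ.sum (λ j → -1ℤ * powers e j)
    ≡⟨ cong (_+_ (ℤΣ.sum (powers (e * (+ 2) ^ k)))) (ℤΣ.*-distribˡ-sum -1ℤ (powers e)) ⟨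
  ℤΣ.sum (powers (e * (+ 2) ^ k)) + -1ℤ * ℤΣ.sum (powers e)
    ≡⟨ cong₂ (λ a b → a + -1ℤ * b) (sum-binomial m (e * (+ 2) ^ k)) (sum-binomial m e) ⟩
  (+ 1 + e * (+ 2) ^ k) ^ m + -1ℤ * (+ 1 + e) ^ m
    ≡⟨ cong (_+_ ((+ 1 + e * (+ 2) ^ k) ^ m)) (ℤ.-1*i≡-i ((+ 1 + e) ^ m)) ⟩
  (+ 1 + e * (+ 2) ^ k) ^ m - (+ 1 + e) ^ m ∎
  where
  powers : ℤ → Vector ℤ (suc m)
  powers x j = + (m C toℕ j) * x ^ toℕ j

  term : ∀ n → e ^ n * + (m C n) * M (k ℕ.* n)
    ≡ + (m C n) * (e * (+ 2) ^ k) ^ n + -1ℤ * (+ (m C n) * e ^ n)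
  term n = begin
    e ^ n * + (m C n) * M (k ℕ.* n)
      ≡⟨ cong (e ^ n * + (m C n) *_) (M-closed (k ℕ.* n)) ⟩
    e ^ n * + (m C n) * ((+ 2) ^ (k ℕ.* n) - + 1)
      ≡⟨ cong (λ q → e ^ n * + (m C n) * (q - + 1)) (ℤ.^-*-assoc (+ 2) k n) ⟨
    e ^ n * + (m C n) * (((+ 2) ^ k) ^ n - + 1)
      ≡⟨ solve 3 (λ a c q → a :* c :* (q :- con (+ 1))
                    := c :* (a :* q) :+ con -1ℤ :* (c :* a))
           refl (e ^ n) (+ (m C n)) (((+ 2) ^ k) ^ n) ⟩
    + (m C n) * (e ^ n * ((+ 2) ^ k) ^ n) + -1ℤ * (+ (m C n) * e ^ n)
      ≡⟨ cong (λ p → + (m C n) * p + -1ℤ * (+ (m C n) * e ^ n))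
           ([i*j]^n≡i^n*j^n e ((+ 2) ^ k) n) ⟨
    + (m C n) * (e * (+ 2) ^ k) ^ n + -1ℤ * (+ (m C n) * e ^ n) ∎
    where open +-*-Solver

-- All terms share the factor `1/M`; pulling it out leaves a sum of integers, where the binomial
-- identity applies.
sum-higherM : ∀ k .{{_ : ℕ.NonZero k}} m (c : ℕ → ℤ) →
  let instance _ = Mₖ≢0 k in
  ∑[ n ≤ m ] (fromℤ (c (toℕ n)) ℚ.* higherM k (toℕ n))
    ≡ ℤΣ.sum {suc m} (λ n → c (toℕ n) * M (k ℕ.* toℕ n)) ÷ℤ M k
sum-higherM k m c = begin
  ∑[ n ≤ m ] (fromℤ (c (toℕ n)) ℚ.* (fromℤ (M (k ℕ.* toℕ n)) ℚ.* 1/M))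
    ≡⟨ ℚΣ.sum-cong-≗ {suc m} (λ n → term (toℕ n)) ⟩
  ∑[ n ≤ m ] (fromℤ (c (toℕ n) * M (k ℕ.* toℕ n)) ℚ.* 1/M)
    ≡⟨ ℚΣ.*-distribʳ-sum 1/M (fromℤ ∘ weighted) ⟨
  (∑[ n ≤ m ] fromℤ (c (toℕ n) * M (k ℕ.* toℕ n))) ℚ.* 1/M
    ≡⟨ cong (ℚ._* 1/M) (fromℤ-homo-sum weighted) ⟨
  fromℤ (ℤΣ.sum {suc m} (λ n → c (toℕ n) * M (k ℕ.* toℕ n))) ℚ.* 1/M ∎
  where
  instance _ = Mₖ≢0 k

  1/M : ℚ
  1/M = ℚ.1/ fromℤ (M k)

  weighted : Vector ℤ (suc m)
  weighted n = c (toℕ n) * M (k ℕ.* toℕ n)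

  term : ∀ n → fromℤ (c n) ℚ.* (fromℤ (M (k ℕ.* n)) ℚ.* 1/M)
    ≡ fromℤ (c n * M (k ℕ.* n)) ℚ.* 1/M
  term n = trans (sym (ℚ.*-assoc (fromℤ (c n)) (fromℤ (M (k ℕ.* n))) 1/M))
    (cong (ℚ._* 1/M) (sym (fromℤ-homo-* (c n) (M (k ℕ.* n)))))

sum-binomial-higherM : ∀ k .{{_ : ℕ.NonZero k}} e m →
  let instance _ = Mₖ≢0 k in
  ∑[ n ≤ m ] (fromℤ (e ^ toℕ n * + (m C toℕ n)) ℚ.* higherM k (toℕ n))
    ≡ ((+ 1 + e * (+ 2) ^ k) ^ m - (+ 1 + e) ^ m) ÷ℤ M k
sum-binomial-higherM k e m =
  trans (sum-higherM k m (λ n → e ^ n * + (m C n)))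
        (cong (_÷ℤ M k) (sum-binomial-M k e m))
  where instance _ = Mₖ≢0 k

1-2^k≡-1*Mₖ : ∀ k → + 1 + -1ℤ * (+ 2) ^ k ≡ -1ℤ * M k
1-2^k≡-1*Mₖ k = trans
  (solve 1 (λ q → con (+ 1) :+ con -1ℤ :* q := con -1ℤ :* (q :- con (+ 1))) refl ((+ 2) ^ k))
  (cong (-1ℤ *_) (sym (M-closed k)))
  where open +-*-Solver

-- The positive exponent matters twice: it makes the power of `+ 1 + -1ℤ` vanish, and it supplies
-- the last factor `M k`, set apart for cancellation against the divisor.
alternating-numerator : ∀ k m →
  (+ 1 + -1ℤ * (+ 2) ^ k) ^ suc m - (+ 1 + -1ℤ) ^ suc m ≡ -1ℤ ^ suc m * M k ^ m * M k
alternating-numerator k m = begin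
  -- `+ 1 + -1ℤ` evaluates to `0ℤ`, and its power unfolds by one factor.
  (+ 1 + -1ℤ * (+ 2) ^ k) ^ suc m - 0ℤ * 0ℤ ^ m
    ≡⟨ cong₂ (λ a b → a ^ suc m - b) (1-2^k≡-1*Mₖ k) (ℤ.*-zeroˡ (0ℤ ^ m)) ⟩
  (-1ℤ * M k) ^ suc m - 0ℤ     ≡⟨ ℤ.+-identityʳ _ ⟩
  (-1ℤ * M k) ^ suc m          ≡⟨ [i*j]^n≡i^n*j^n -1ℤ (M k) (suc m) ⟩
  -1ℤ ^ suc m * (M k * M k ^ m) ≡⟨ cong (-1ℤ ^ suc m *_) (ℤ.*-comm (M k) (M k ^ m)) ⟩
  -1ℤ ^ suc m * (M k ^ m * M k) ≡⟨ ℤ.*-assoc (-1ℤ ^ suc m) (M k ^ m) (M k) ⟨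
  -1ℤ ^ suc m * M k ^ m * M k  ∎

-- The second identity starts at `s = 2`: for `s = 1` its sum is 0, while the inverse of `M k` is
-- nonzero.
theorem2p20 : (k : ℕ) .{{_ : ℕ.NonZero k}} →
    let instance _ = 2^k-1≢0 k in
    ((s : ℕ) → 1 ≤ s →
    ∑[ n ≤ s ∸ 1 ] (fromℤ (+ ((s ∸ 1) C toℕ n)) ℚ.* higherM k (toℕ n))
    ≡ ((+ 1 + (+ 2) ^ k) ^ (s ∸ 1) - (+ 2) ^ (s ∸ 1)) ÷ℤ ((+ 2) ^ k - + 1))
    ×
    ((s : ℕ) → 2 ≤ s →
    ∑[ n ≤ s ∸ 1 ] (fromℤ (-1ℤ ^ toℕ n * + ((s ∸ 1) C toℕ n)) ℚ.* higherM k (toℕ n))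
    ≡ fromℤ (-1ℤ ^ (s ∸ 1) * M k ^ (s ∸ 2)))
theorem2p20 k = plain , alternating
  where
  instance
    _ = 2^k-1≢0 k
    _ = Mₖ≢0 k

  1^n*i≡i : ∀ n i → 1ℤ ^ n * i ≡ i
  1^n*i≡i n i = trans (cong (_* i) (ℤ.^-zeroˡ n)) (ℤ.*-identityˡ i)

  plain : (s : ℕ) → 1 ≤ s →
    ∑[ n ≤ s ∸ 1 ] (fromℤ (+ ((s ∸ 1) C toℕ n)) ℚ.* higherM k (toℕ n))
      ≡ ((+ 1 + (+ 2) ^ k) ^ (s ∸ 1) - (+ 2) ^ (s ∸ 1)) ÷ℤ ((+ 2) ^ k - + 1)
  plain (suc m) _ = begin
    ∑[ n ≤ m ] (fromℤ (+ (m C toℕ n)) ℚ.* higherM k (toℕ n))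
      -- Inserting the weight `1ℤ ^ n` gives the general sum at `e = 1`, whose second base
      -- `+ 1 + 1ℤ` evaluates to `+ 2`.
      ≡⟨ ℚΣ.sum-cong-≗ {suc m} (λ n → cong (λ c → fromℤ c ℚ.* higherM k (toℕ n))
           (1^n*i≡i (toℕ n) (+ (m C toℕ n)))) ⟨
    ∑[ n ≤ m ] (fromℤ (1ℤ ^ toℕ n * + (m C toℕ n)) ℚ.* higherM k (toℕ n))
      ≡⟨ sum-binomial-higherM k 1ℤ m ⟩
    ((+ 1 + 1ℤ * (+ 2) ^ k) ^ m - (+ 2) ^ m) ÷ℤ M k
      ≡⟨ cong (λ q → ((+ 1 + q) ^ m - (+ 2) ^ m) ÷ℤ M k) (ℤ.*-identityˡ ((+ 2) ^ k)) ⟩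
    ((+ 1 + (+ 2) ^ k) ^ m - (+ 2) ^ m) ÷ℤ M k
      ≡⟨ ÷ℤ-congʳ ((+ 1 + (+ 2) ^ k) ^ m - (+ 2) ^ m) (M-closed k) ⟩
    ((+ 1 + (+ 2) ^ k) ^ m - (+ 2) ^ m) ÷ℤ ((+ 2) ^ k - + 1) ∎

  alternating : (s : ℕ) → 2 ≤ s →
    ∑[ n ≤ s ∸ 1 ] (fromℤ (-1ℤ ^ toℕ n * + ((s ∸ 1) C toℕ n)) ℚ.* higherM k (toℕ n))
      ≡ fromℤ (-1ℤ ^ (s ∸ 1) * M k ^ (s ∸ 2))
  alternating 1 (s≤s ())
  -- Here `s ∸ 1` is `suc m` and `s ∸ 2` is `m`, so neither subtraction is truncated.
  alternating (suc (suc m)) _ = begin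
    ∑[ n ≤ suc m ] (fromℤ (-1ℤ ^ toℕ n * + (suc m C toℕ n)) ℚ.* higherM k (toℕ n))
      ≡⟨ sum-binomial-higherM k -1ℤ (suc m) ⟩
    ((+ 1 + -1ℤ * (+ 2) ^ k) ^ suc m - (+ 1 + -1ℤ) ^ suc m) ÷ℤ M k
      ≡⟨ cong (_÷ℤ M k) (alternating-numerator k m) ⟩
    (-1ℤ ^ suc m * M k ^ m * M k) ÷ℤ M k
      ≡⟨ i*j÷ℤj≡i (-1ℤ ^ suc m * M k ^ m) (M k) ⟩
    fromℤ (-1ℤ ^ suc m * M k ^ m) ∎
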